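{- There is a constant $c>0$ such that for every positive integer $r$ there exist a finite biclique and a spanning partition of it into $r$ bi-equivalence graphs $G_1,\dots,G_r$ such that each $G_i$ has width at least $c\,r^{3/2}$.
   Context: A biclique $[X,Y]$ is a complete bipartite graph with nonempty vertex classes $X$ and $Y$. A bi-equivalence graph is a graph each of whose connected components is a biclique. A partition of a biclique $G$ into bi-equivalence graphs $G_1,\dots,G_r$ means that every edge of $G$ belongs to exactly one $G_i$, each $G_i$ being a bi-equivalence graph. The partition is spanning if every vertex of $G$ is incident with at least one edge of each $G_i$. The width of $G_i$ is the number of its connected components. -}

module Defs where

open import Data.Fin.Base using (Fin)
open import Data.Integer.Base using (+_)
open import Data.Nat.Base as ℕ using (ℕ)
open import Data.Product using (Σ; ∃; ∃!; _×_; _,_; proj₁)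
open import Data.Rational.Base as ℚ using (ℚ)
open import Data.Sum.Base using (_⊎_)
open import Function.Base using (_on_)
open import Function.Bundles using (Bijection; _⇔_)
open import Level using (0ℓ)
open import Relation.Binary.Bundles using (Setoid)
open import Relation.Binary.Core using (Rel; _⇒_)
open import Relation.Binary.Construct.Closure.ReflexiveTransitive using (Star; ε; _◅◅_; reverse)
open import Relation.Binary.Definitions using (Symmetric)
open import Relation.Binary.PropositionalEquality using (_≡_)
import Relation.Binary.PropositionalEquality.Properties as ≡
open import Relation.Nullary.Negation using (¬_)
open import Relation.Unary using (Pred; _∈_; _⊆_; _∩_; _∪_; _≐_; Satisfiable; Empty)

-- Simple graphs whose vertices form a subset of an ambient type V, so that
-- subgraphs and components of a graph are again graphs over V.
record Graph (V : Set) : Set₁ where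
  field
    Vertex   : Pred V 0ℓ
    Adj      : Rel V 0ℓ
    adj-vtx  : ∀ {u v} → Adj u v → u ∈ Vertex × v ∈ Vertex
    adj-sym  : Symmetric Adj
    adj-irr  : ∀ {v} → ¬ Adj v v

open Graph public

module _ {V : Set} where

  induced : Graph V → Pred V 0ℓ → Graph V
  induced G S = record
    { Vertex  = Vertex G ∩ S
    ; Adj     = λ u v → Adj G u v × u ∈ S × v ∈ S
    ; adj-vtx = λ (uv , u∈S , v∈S) →
        let (u∈G , v∈G) = adj-vtx G uv in (u∈G , u∈S) , (v∈G , v∈S)
    ; adj-sym = λ (uv , u∈S , v∈S) → adj-sym G uv , v∈S , u∈S
    ; adj-irr = λ (vv , _) → adj-irr G vv
    }

  record _IsSubgraphOf_ (H G : Graph V) : Set where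
    field
      vertices : Vertex H ⊆ Vertex G
      edges    : Adj H ⇒ Adj G

  Connected : Graph V → Rel V 0ℓ
  Connected G = Star (Adj G)

  component : Graph V → V → Graph V
  component G v = induced G (Connected G v)

  record IsBiclique (G : Graph V) : Set₁ where
    field
      X Y        : Pred V 0ℓ
      X-nonempty : Satisfiable X
      Y-nonempty : Satisfiable Y
      disjoint   : Empty (X ∩ Y)
      vertices   : Vertex G ≐ X ∪ Y
      edges      : ∀ u v → Adj G u v ⇔ (u ∈ X × v ∈ Y ⊎ u ∈ Y × v ∈ X)

  IsBiEquivalence : Graph V → Set₁
  IsBiEquivalence G = ∀ v → v ∈ Vertex G → IsBiclique (component G v)

  -- The set of connected components: vertices modulo connectedness.
  Components : Graph V → Setoid 0ℓ 0ℓ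
  Components G = record
    { Carrier       = Σ V (Vertex G)
    ; _≈_           = Connected G on proj₁
    ; isEquivalence = record { refl = ε ; sym = reverse (adj-sym G) ; trans = _◅◅_ }
    }

  HasWidth : Graph V → ℕ → Set
  HasWidth G w = Bijection (≡.setoid (Fin w)) (Components G)

  record IsPartition (K : Graph V) {r : ℕ} (G : Fin r → Graph V) : Set₁ where
    field
      subgraph      : ∀ i → G i IsSubgraphOf K
      biEquivalence : ∀ i → IsBiEquivalence (G i)
      exactlyOne    : ∀ u v → Adj K u v → ∃! _≡_ λ i → Adj (G i) u v

  IsSpanning : Graph V → {r : ℕ} → (Fin r → Graph V) → Set
  IsSpanning K G = ∀ v → v ∈ Vertex K → ∀ i → ∃ λ u → Adj (G i) v u

fromℕ : ℕ → ℚ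
fromℕ n = + n ℚ./ 1

-- c · r^{3/2} ≤ w with both sides squared, which for c ≥ 0 is equivalent.
_·_^3/2≤_ : ℚ → ℕ → ℕ → Set
c · r ^3/2≤ w = (c ℚ.* c) ℚ.* fromℕ (r ℕ.^ 3) ℚ.≤ fromℕ (w ℕ.^ 2)

-- The vertices on each side fall into k + 1 ≈ √r / 2 groups. Between a left
-- vertex and a right vertex of the same group the colour is read off a Latin
-- square of order at least r / 2, so each group contributes at least r / 2
-- components to each colour. Vertices of different groups meet only in one further
-- component of some colours, the star: for every ordered pair (l , l′) of
-- distinct groups, four colours (i , j) are reserved, in which the star joins the
-- left vertices of l with tag i to the right vertices of l′ with tag j. A colour
-- reserved by the star for half of the vertices of a group remains available to
-- the other half, so the Latin square still reaches every vertex in every colour.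

module Submission where

open import Data.Bool.Base using (Bool; true; false; not; _xor_)
import Data.Bool.Properties as Bool
open import Data.Fin.Base using (Fin; zero; suc; toℕ; fromℕ<; punchIn; punchOut)
import Data.Fin.Properties as Fin
open import Data.Integer.Base as ℤ using (+_)
import Data.Integer.Properties as ℤ
open import Data.Maybe.Base using (Maybe; just; nothing)
open import Data.Maybe.Properties using (just-injective; ≡-dec)
open import Data.Nat.Base as ℕ using (ℕ; zero; suc; _+_; _*_; _∸_; _^_; _≤_; NonZero; z≤n; s≤s; s≤s⁻¹)
import Data.Nat.Properties as ℕ
open import Data.Nat.Tactic.RingSolver using (solve-∀)
open import Data.Product using (∃!)
open import Data.Product.Base using (Σ; ∃; _×_; _,_; proj₁; proj₂)
open import Data.Product.Function.NonDependent.Propositional using (_×-↔_)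
import Data.Product.Properties as Product
open import Data.Rational.Base as ℚ using (ℚ; 0ℚ; _<_; toℚᵘ)
import Data.Rational.Properties as ℚ
open import Data.Rational.Unnormalised.Base as ℚᵘ using (mkℚᵘ; *≤*)
import Data.Rational.Unnormalised.Properties as ℚᵘ
open import Data.Sum.Base as Sum using (_⊎_; inj₁; inj₂)
open import Data.Sum.Function.Propositional using (_⊎-↔_)
import Data.Sum.Properties as Sum
open import Data.Unit.Base using (⊤; tt)
open import Function.Base using (_∘_; id)
open import Function.Bundles using (_⇔_; mk⇔; Equivalence; Injection; _↔_; Inverse)
open import Function.Construct.Composition using (_↔-∘_)
open import Function.Construct.Identity using (↔-id)
open import Function.Properties.Inverse using (↔⇒↣)
open import Relation.Binary.Construct.Closure.ReflexiveTransitive using (ε; _◅_)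
open import Relation.Binary.Definitions using (DecidableEquality)
open import Relation.Binary.PropositionalEquality
  using (_≡_; _≢_; refl; sym; trans; cong; subst; ≢-sym)
open import Relation.Nullary using (yes; no; contradiction)
open import Relation.Unary using (Pred; _∈_; _≐_)
open import Defs

-- Spanning partitions of bicliques from vertex labellings.

-- An index is kept exactly when no later index has its value. Applied to a labelling of vertices by
-- components, `rep` becomes the bijection that witnesses the width.
finite-image : ∀ {S : Set} → DecidableEquality S → ∀ {n} (s : Fin n → S) →
  ∃ λ w → Σ (Fin w → Fin n) λ rep →
    (∀ x y → s (rep x) ≡ s (rep y) → x ≡ y) × (∀ v → ∃ λ x → s (rep x) ≡ s v)
finite-image _≟_ {zero} s = 0 , (λ ()) , (λ ()) , λ ()
finite-image _≟_ {suc n} s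
  with w , rep , inj , sur ← finite-image _≟_ (s ∘ suc)
  with Fin.any? (λ x → s (suc (rep x)) ≟ s zero)
... | yes old = w , suc ∘ rep , inj , λ { zero → old ; (suc v) → sur v }
... | no new = suc w , rep⁺ , inj⁺ , λ { zero → zero , refl ; (suc v) → let x , eq = sur v in suc x , eq }
  where
  rep⁺ : Fin (suc w) → Fin (suc n)
  rep⁺ zero    = zero
  rep⁺ (suc x) = suc (rep x)

  inj⁺ : ∀ x y → s (rep⁺ x) ≡ s (rep⁺ y) → x ≡ y
  inj⁺ zero    zero    _  = refl
  inj⁺ zero    (suc y) eq = contradiction (y , sym eq) new
  inj⁺ (suc x) zero    eq = contradiction (x , eq) new
  inj⁺ (suc x) (suc y) eq = cong suc (inj x y eq)

module _ {V : Set} (side : V → Bool) where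

  -- Serves both for the ambient biclique, where `P` is everything, and for a component, where `P`
  -- is one label class.
  bicoloured-biclique : (H : Graph V) (P : Pred V _) →
    (∀ b → ∃ λ v → side v ≡ b × v ∈ P) → Vertex H ≐ P →
    (∀ u v → Adj H u v ⇔ (side u ≢ side v × u ∈ P × v ∈ P)) → IsBiclique H
  bicoloured-biclique H P inhabited (H⊆P , P⊆H) adj = record
    { X = X true ; Y = X false
    ; X-nonempty = inhabited true
    ; Y-nonempty = inhabited false
    ; disjoint = λ v ((eq , _) , (eq′ , _)) → contradiction (trans (sym eq) eq′) λ ()
    ; vertices = (λ v∈H → split _ (H⊆P v∈H)) , Sum.[ P⊆H ∘ proj₂ , P⊆H ∘ proj₂ ]
    ; edges = λ u v → mk⇔ (to u v ∘ Equivalence.to (adj u v)) (Equivalence.from (adj u v) ∘ from u v)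
    }
    where
    X : Bool → Pred V _
    X b v = side v ≡ b × v ∈ P

    split : ∀ v → v ∈ P → v ∈ X true ⊎ v ∈ X false
    split v v∈P with side v
    ... | true  = inj₁ (refl , v∈P)
    ... | false = inj₂ (refl , v∈P)

    to : ∀ u v → side u ≢ side v × u ∈ P × v ∈ P → u ∈ X true × v ∈ X false ⊎ u ∈ X false × v ∈ X true
    to u v (u≢v , u∈P , v∈P) with side u | side v
    ... | true  | true  = contradiction refl u≢v
    ... | true  | false = inj₁ ((refl , u∈P) , (refl , v∈P))
    ... | false | true  = inj₂ ((refl , u∈P) , (refl , v∈P))
    ... | false | false = contradiction refl u≢v

    from : ∀ u v → u ∈ X true × v ∈ X false ⊎ u ∈ X false × v ∈ X true → side u ≢ side v × u ∈ P × v ∈ P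
    from u v (inj₁ ((p , u∈P) , (q , v∈P))) = (λ eq → contradiction (trans (sym p) (trans eq q)) λ ()) , u∈P , v∈P
    from u v (inj₂ ((p , u∈P) , (q , v∈P))) = (λ eq → contradiction (trans (sym p) (trans eq q)) λ ()) , u∈P , v∈P

-- A spanning bi-equivalence graph amounts to a labelling of the vertices by
-- components in which every label occurs on both sides.
module Labelled {n r : ℕ} {S : Set} (_≟_ : DecidableEquality S)
  (side : Fin n → Bool) (label : Fin r → Fin n → S)
  (bothSides : ∀ b → ∃ λ v → side v ≡ b)
  (neighbour : ∀ i v → ∃ λ u → side v ≢ side u × label i v ≡ label i u)
  (agreeOnce : ∀ u v → side u ≢ side v → ∃! _≡_ λ i → label i u ≡ label i v)
  where

  K : Graph (Fin n)
  K = record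
    { Vertex = λ _ → ⊤
    ; Adj = λ u v → side u ≢ side v
    ; adj-vtx = λ _ → tt , tt
    ; adj-sym = ≢-sym
    ; adj-irr = λ v≢v → v≢v refl
    }

  G : Fin r → Graph (Fin n)
  G i = record
    { Vertex = λ _ → ⊤
    ; Adj = λ u v → side u ≢ side v × label i u ≡ label i v
    ; adj-vtx = λ _ → tt , tt
    ; adj-sym = λ (u≢v , eq) → ≢-sym u≢v , sym eq
    ; adj-irr = λ (v≢v , _) → v≢v refl
    }

  connected⇒label : ∀ i {u v} → Connected (G i) u v → label i u ≡ label i v
  connected⇒label i ε             = refl
  connected⇒label i ((_ , eq) ◅ c) = trans eq (connected⇒label i c)

  label⇒connected : ∀ i {u v} → label i u ≡ label i v → Connected (G i) u v
  label⇒connected i {u} {v} eq with side u Bool.≟ side v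
  ... | no u≢v  = (u≢v , eq) ◅ ε
  -- Two vertices on the same side are joined by a path of length two through a neighbour of `u`,
  -- which lies on the opposite side.
  ... | yes u≡v with x , u≢x , eqx ← neighbour i u =
    (u≢x , eqx) ◅ ((λ x≡v → u≢x (trans u≡v (sym x≡v))) , trans (sym eqx) eq) ◅ ε

  K-biclique : IsBiclique K
  K-biclique = bicoloured-biclique side K (λ _ → ⊤)
    (λ b → let v , eq = bothSides b in v , eq , tt) (id , id)
    λ u v → mk⇔ (λ u≢v → u≢v , tt , tt) proj₁

  partition : IsPartition K G
  partition = record
    { subgraph = λ i → record { vertices = id ; edges = proj₁ }
    ; biEquivalence = λ i v _ → bicoloured-biclique side (component (G i) v) (λ u → label i v ≡ label i u)
        (class i v) (connected⇒label i ∘ proj₂ , λ eq → tt , label⇒connected i eq)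
        λ u w → mk⇔
          (λ ((u≢w , _) , vu , vw) → u≢w , connected⇒label i vu , connected⇒label i vw)
          (λ (u≢w , vu , vw) → (u≢w , trans (sym vu) vw) , label⇒connected i vu , label⇒connected i vw)
    ; exactlyOne = λ u v u≢v → let i , eq , unique = agreeOnce u v u≢v in i , (u≢v , eq) , unique ∘ proj₂
    }
    where
    class : ∀ i v b → ∃ λ u → side u ≡ b × label i v ≡ label i u
    class i v b with side v Bool.≟ b
    ... | yes eq  = v , eq , refl
    ... | no v≢b with u , v≢u , eq ← neighbour i v =
      u , trans (Bool.¬-not (≢-sym v≢u)) (sym (Bool.¬-not (≢-sym v≢b))) , eq

  spanning : IsSpanning K G
  spanning v _ i = neighbour i v

  -- Differently labelled vertices have different representatives, so sending `x` to the
  -- representative of `h x` is injective and pigeonhole gives `m ≤ w`.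
  width : ∀ i {m} (h : Fin m → Fin n) → (∀ x y → label i (h x) ≡ label i (h y) → x ≡ y) →
    ∃ λ w → HasWidth (G i) w × m ≤ w
  width i h h-inj with w , rep , rep-inj , rep-sur ← finite-image _≟_ (label i) =
    w , bijection , Fin.injective⇒≤ {f = proj₁ ∘ rep-sur ∘ h} λ {x} {y} eq →
      h-inj x y (trans (sym (proj₂ (rep-sur (h x)))) (trans (cong (label i ∘ rep) eq) (proj₂ (rep-sur (h y)))))
    where
    bijection : HasWidth (G i) w
    bijection = record
      { to = λ x → rep x , tt
      ; cong = λ { refl → ε }
      ; bijective =
          (λ {x} {y} c → rep-inj x y (connected⇒label i c)) ,
          λ (v , _) → let x , eq = rep-sur v in x , λ { refl → label⇒connected i eq }
      }

-- Totally symmetric quasigroups, which supply the Latin squares.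

-- The relation `x ∙ y ≡ z` is invariant under all permutations of its three entries, so the one
-- operation also serves as both divisions.
record TotallySymmetricQuasigroup (D : Set) : Set where
  infixl 7 _∙_
  field
    _∙_    : D → D → D
    comm   : ∀ x y → x ∙ y ≡ y ∙ x
    cancel : ∀ x y → x ∙ (x ∙ y) ≡ y

  ∙-swap : ∀ x y {z} → x ∙ y ≡ z → x ≡ y ∙ z
  ∙-swap x y refl = sym (trans (cong (y ∙_) (comm x y)) (cancel y x))

-- x ∙ y is the residue of n − x − y modulo n + 1.
fin-quasigroup : ∀ n → TotallySymmetricQuasigroup (Fin n)
fin-quasigroup zero = record { _∙_ = λ () ; comm = λ () ; cancel = λ () }
fin-quasigroup (suc n) = record
  { _∙_ = λ x y → proj₁ (third x y)
  ; comm = λ x y → unique x y (proj₂ (third x y)) (swap x y (proj₂ (third y x)))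
  ; cancel = λ x y → let z , xyz = third x y in unique x z (proj₂ (third x z)) (rotate x y xyz)
  }
  where
  -- Congruence of the sum to `n` modulo `n + 1`. The sum is at most `3 n`, which leaves only the
  -- values `n` and `2 n + 1`.
  Collinear : (x y z : Fin (suc n)) → Set
  Collinear x y z = toℕ x + toℕ y + toℕ z ≡ n ⊎ toℕ x + toℕ y + toℕ z ≡ n + suc n

  swap : ∀ x y {z} → Collinear y x z → Collinear x y z
  swap x y {z} = subst (λ s → s + toℕ z ≡ n ⊎ s + toℕ z ≡ n + suc n) (ℕ.+-comm (toℕ y) (toℕ x))

  rotate : ∀ x y {z} → Collinear x y z → Collinear x z y
  rotate x y {z} = subst (λ s → s ≡ n ⊎ s ≡ n + suc n) (lemma (toℕ x) (toℕ y) (toℕ z))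
    where
    lemma : ∀ a b c → a + b + c ≡ a + c + b
    lemma = solve-∀

  third : ∀ x y → ∃ (Collinear x y)
  third x y with toℕ x + toℕ y ℕ.≤? n
  ... | yes s≤n = fromℕ< z<1+n , inj₁ (trans (cong ((toℕ x + toℕ y) ℕ.+_) (Fin.toℕ-fromℕ< z<1+n)) (ℕ.m+[n∸m]≡n s≤n))
    where
    z<1+n : n ∸ (toℕ x + toℕ y) ℕ.< suc n
    z<1+n = s≤s (ℕ.m∸n≤m n (toℕ x + toℕ y))
  ... | no s≰n = fromℕ< z<1+n , inj₂ (trans (cong ((toℕ x + toℕ y) ℕ.+_) (Fin.toℕ-fromℕ< z<1+n)) (ℕ.m+[n∸m]≡n s≤2n+1))
    where
    s≤2n+1 : toℕ x + toℕ y ≤ n + suc n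
    s≤2n+1 = ℕ.+-mono-≤ (s≤s⁻¹ (Fin.toℕ<n x)) (ℕ.<⇒≤ (Fin.toℕ<n y))
    z<1+n : n + suc n ∸ (toℕ x + toℕ y) ℕ.< suc n
    z<1+n = s≤s (ℕ.≤-trans (ℕ.∸-monoʳ-≤ (n + suc n) (ℕ.≰⇒> s≰n)) (ℕ.≤-reflexive (ℕ.m+n∸n≡m n (suc n))))

  excess : ∀ s (z z′ : Fin (suc n)) → s + toℕ z ≡ n → s + toℕ z′ ≢ n + suc n
  excess s z z′ eq eq′ = ℕ.<-irrefl eq′ (ℕ.+-mono-≤-< (subst (s ≤_) eq (ℕ.m≤m+n s (toℕ z))) (Fin.toℕ<n z′))

  unique : ∀ x y {z z′} → Collinear x y z → Collinear x y z′ → z ≡ z′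
  unique x y (inj₁ p) (inj₁ q) = Fin.toℕ-injective (ℕ.+-cancelˡ-≡ (toℕ x + toℕ y) _ _ (trans p (sym q)))
  unique x y {z} {z′} (inj₁ p) (inj₂ q) = contradiction q (excess (toℕ x + toℕ y) z z′ p)
  unique x y {z} {z′} (inj₂ p) (inj₁ q) = contradiction p (excess (toℕ x + toℕ y) z′ z q)
  unique x y (inj₂ p) (inj₂ q) = Fin.toℕ-injective (ℕ.+-cancelˡ-≡ (toℕ x + toℕ y) _ _ (trans p (sym q)))

quasigroup-transport : ∀ {D E : Set} → E ↔ D → TotallySymmetricQuasigroup E → TotallySymmetricQuasigroup D
quasigroup-transport E↔D Q = record
  { _∙_ = λ x y → to (from x ∙ from y)
  ; comm = λ x y → cong to (comm (from x) (from y))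
  ; cancel = λ x y → trans (cong (λ e → to (from x ∙ e)) (strictlyInverseʳ (from x ∙ from y)))
      (trans (cong to (cancel (from x) (from y))) (strictlyInverseˡ y))
  }
  where
  open Inverse E↔D
  open TotallySymmetricQuasigroup Q

-- Number of groups and numerical estimates.

-- With k + 1 groups, 4 k (k + 1) colours are reserved for the star.
group-count : ∀ r → ∃ λ k → suc k * k * 4 ≤ r × r ℕ.< suc (suc k) * suc k * 4
group-count zero = 0 , z≤n , s≤s z≤n
group-count (suc r) with k , lo , hi ← group-count r with suc r ℕ.<? suc (suc k) * suc k * 4
... | yes hi′ = k , ℕ.m≤n⇒m≤1+n lo , hi′
... | no hi≰  = suc k , ℕ.≮⇒≥ hi≰ , ℕ.≤-<-trans hi (ℕ.*-monoˡ-< 4 (ℕ.*-mono-< (ℕ.n<1+n (suc (suc k))) (ℕ.n<1+n (suc k))))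

-- With `m = suc k` groups and `d` differences, `r ≤ 2 d`, and the upper bound on `r` gives
-- `r ≤ 8 m²`. Multiplying yields `r³ ≤ 32 (m d)²`.
cube-bound : ∀ k n {w} → let r = suc k * k * 4 + n in r ℕ.< suc (suc k) * suc k * 4 →
  suc k * (suc k * k * 2 + n) ≤ w → r ^ 3 ≤ 36 * w ^ 2
cube-bound k n {w} hi wide = begin
  r ^ 3                                     ≡⟨ cube r ⟩
  r * (r * r)                               ≤⟨ ℕ.*-mono-≤ r≤8m² (ℕ.*-mono-≤ r≤2d r≤2d) ⟩
  8 * (suc k * suc k) * (2 * d * (2 * d))   ≡⟨ regroup (suc k) d ⟩
  -- Raising 32 to the square 36 allows the rational constant 1/6.
  32 * (suc k * d * (suc k * d))            ≤⟨ ℕ.*-mono-≤ (ℕ.m≤m+n 32 4) (ℕ.*-mono-≤ wide wide) ⟩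
  36 * (w * w)                              ≡⟨ cong (36 *_) (square w) ⟨
  36 * w ^ 2                                ∎
  where
  open ℕ.≤-Reasoning
  r = suc k * k * 4 + n
  d = suc k * k * 2 + n
  cube : ∀ x → x * (x * (x * 1)) ≡ x * (x * x)
  cube = solve-∀
  square : ∀ x → x * (x * 1) ≡ x * x
  square = solve-∀
  regroup : ∀ m d → 8 * (m * m) * (2 * d * (2 * d)) ≡ 32 * (m * d * (m * d))
  regroup = solve-∀
  double : ∀ a n → a * 4 + n + n ≡ 2 * (a * 2 + n)
  double = solve-∀
  upper : ∀ k → suc (suc k) * suc k * 4 + suc k * k * 4 ≡ 8 * (suc k * suc k)
  upper = solve-∀
  r≤2d : r ≤ 2 * d
  r≤2d = ℕ.≤-trans (ℕ.m≤m+n r n) (ℕ.≤-reflexive (double (suc k * k) n))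
  r≤8m² : r ≤ 8 * (suc k * suc k)
  r≤8m² = ℕ.≤-trans (ℕ.<⇒≤ hi) (ℕ.≤-trans (ℕ.m≤m+n _ (suc k * k * 4)) (ℕ.≤-reflexive (upper k)))

c : ℚ
c = + 1 ℚ./ 6

0<c : ℚ.0ℚ ℚ.< c
0<c = ℚ.positive⁻¹ c

c-bound : ∀ r w → r ^ 3 ≤ 36 * w ^ 2 → c · r ^3/2≤ w
c-bound r w le = ℚ.toℚᵘ-cancel-≤ (begin
  toℚᵘ (c ℚ.* c ℚ.* fromℕ (r ^ 3))          ≃⟨ ℚ.toℚᵘ-homo-* (c ℚ.* c) (fromℕ (r ^ 3)) ⟩
  toℚᵘ (c ℚ.* c) ℚᵘ.* toℚᵘ (fromℕ (r ^ 3))  ≃⟨ ℚᵘ.*-congˡ {toℚᵘ (c ℚ.* c)} (ℚ.toℚᵘ-fromℚᵘ (mkℚᵘ (+ (r ^ 3)) 0)) ⟩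
  -- This is 1/36, the denominator being stored less one; cross-multiplication reduces the
  -- inequality to `le`.
  mkℚᵘ (+ 1) 35 ℚᵘ.* mkℚᵘ (+ (r ^ 3)) 0     ≤⟨ *≤* (ℤ.≤-trans (ℤ.≤-reflexive lhs) (ℤ.≤-trans (ℤ.+≤+ le) (ℤ.≤-reflexive rhs))) ⟩
  mkℚᵘ (+ (w ^ 2)) 0                        ≃⟨ ℚ.toℚᵘ-fromℚᵘ (mkℚᵘ (+ (w ^ 2)) 0) ⟨
  toℚᵘ (fromℕ (w ^ 2))                      ∎)
  where
  open ℚᵘ.≤-Reasoning
  lhs : (+ 1 ℤ.* + (r ^ 3)) ℤ.* + 1 ≡ + (r ^ 3)
  lhs = trans (ℤ.*-identityʳ _) (ℤ.*-identityˡ _)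
  rhs : + (36 * w ^ 2) ≡ + (w ^ 2) ℤ.* + 36
  rhs = trans (cong +_ (ℕ.*-comm 36 (w ^ 2))) (ℤ.pos-* (w ^ 2) 36)

-- Groups, lines, colours and labels.

xor-cancelˡ : ∀ x y → x xor (x xor y) ≡ y
xor-cancelˡ false y = refl
xor-cancelˡ true  y = Bool.not-involutive y

module Construction (k n : ℕ) where

  -- A line (l , c) encodes the ordered pair of distinct groups l and punchIn l c.
  Group Line Colour Difference : Set
  Group      = Fin (suc k)
  Line       = Fin (suc k) × Fin k
  Colour     = (Line × Bool × Bool) ⊎ Fin n
  Difference = (Line × Bool) ⊎ Fin n

  source target : Line → Group
  source (l , _) = l
  target (l , c) = punchIn l c

  data Role (l : Group) (ρ : Line) : Set where
    isSource : source ρ ≡ l → Role l ρ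
    isTarget : target ρ ≡ l → Role l ρ
    neither  : source ρ ≢ l → target ρ ≢ l → Role l ρ

  role : ∀ l ρ → Role l ρ
  role l ρ with source ρ Fin.≟ l | target ρ Fin.≟ l
  ... | yes s≡l | _       = isSource s≡l
  ... | no _    | yes t≡l = isTarget t≡l
  ... | no s≢l  | no t≢l  = neither s≢l t≢l

  source≢target : ∀ ρ → source ρ ≢ target ρ
  source≢target (l , c) eq = Fin.punchInᵢ≢i l c (sym eq)

  line-unique : ∀ {ρ σ} → source ρ ≡ source σ → target ρ ≡ target σ → ρ ≡ σ
  line-unique {l , c} {_ , d} refl eq = cong (l ,_) (Fin.punchIn-injective l c d eq)

  -- Within a group, the four colours of a line make up two differences. At the
  -- source, the star removes one of (ρ , true , j) and (ρ , false , j), so that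
  -- the two share a difference; likewise at the target. In any other group, both
  -- are in use and the tags decide between them.
  module Labels (Q : TotallySymmetricQuasigroup Difference) where
    open TotallySymmetricQuasigroup Q

    -- A point describes a vertex on either side and also names a component within a group; the
    -- label `nothing` is the star.
    Point Label : Set
    Point = Group × Bool × Difference
    Label = Maybe Point

    guard : Bool → Point → Label
    guard true  p = just p
    guard false p = nothing

    -- Right labels keep `q`, while left labels multiply it by the difference of the colour, so that
    -- agreement within a group is a Latin square equation. `guard` puts a left vertex of the
    -- source, or a right vertex of the target, into the star exactly when its tag is the colour's
    -- tag for that end.
    lineLabelˡ lineLabelʳ : ∀ {l ρ} → Role l ρ → (i j t : Bool) → Difference → Label
    lineLabelˡ {l} {ρ} (isSource _)  i j t q = guard (i xor t) (l , false , inj₁ (ρ , j) ∙ q)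
    lineLabelˡ {l} {ρ} (isTarget _)  i j t q = just (l , false , inj₁ (ρ , i) ∙ q)
    lineLabelˡ {l} {ρ} (neither _ _) i j t q = just (l , t xor i , inj₁ (ρ , j) ∙ q)
    lineLabelʳ {l} {ρ} (isSource _)  i j t q = just (l , false , q)
    lineLabelʳ {l} {ρ} (isTarget _)  i j t q = guard (j xor t) (l , false , q)
    lineLabelʳ {l} {ρ} (neither _ _) i j t q = just (l , t , q)

    labelˡ labelʳ : Colour → Point → Label
    labelˡ (inj₁ (ρ , i , j)) (l , t , q) = lineLabelˡ (role l ρ) i j t q
    labelˡ (inj₂ x)           (l , t , q) = just (l , false , inj₂ x ∙ q)
    labelʳ (inj₁ (ρ , i , j)) (l , t , q) = lineLabelʳ (role l ρ) i j t q
    labelʳ (inj₂ x)           (l , t , q) = just (l , false , q)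

    guard-group : ∀ b {l x l′ x′} → guard b (l , x) ≡ just (l′ , x′) → l ≡ l′
    guard-group true refl = refl

    guard-star : ∀ i t {p} → guard (i xor t) p ≡ nothing → i ≡ t
    guard-star false false _ = refl
    guard-star true  true  _ = refl

    guard-same : ∀ t p → guard (t xor t) p ≡ nothing
    guard-same false p = refl
    guard-same true  p = refl

    guard-not : ∀ t p → guard (not t xor t) p ≡ just p
    guard-not false p = refl
    guard-not true  p = refl

    guard-just : ∀ i t {p p′} → guard (i xor t) p ≡ just p′ → i ≡ not t × p ≡ p′
    guard-just false true refl = refl , refl
    guard-just true false refl = refl , refl

    starˡ : ∀ {l ρ i j t q} (R : Role l ρ) → lineLabelˡ R i j t q ≡ nothing → source ρ ≡ l × i ≡ t
    starˡ {i = i} {t = t} (isSource s≡l) eq = s≡l , guard-star i t eq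

    starʳ : ∀ {l ρ i j t q} (R : Role l ρ) → lineLabelʳ R i j t q ≡ nothing → target ρ ≡ l × j ≡ t
    starʳ {j = j} {t = t} (isTarget t≡l) eq = t≡l , guard-star j t eq

    groupˡ : ∀ {l ρ i j t q l′ x} (R : Role l ρ) → lineLabelˡ R i j t q ≡ just (l′ , x) → l ≡ l′
    groupˡ {i = i} {t = t} (isSource _) eq = guard-group (i xor t) eq
    groupˡ (isTarget _)  refl = refl
    groupˡ (neither _ _) refl = refl

    groupʳ : ∀ {l ρ i j t q l′ x} (R : Role l ρ) → lineLabelʳ R i j t q ≡ just (l′ , x) → l ≡ l′
    groupʳ (isSource _) refl = refl
    groupʳ {j = j} {t = t} (isTarget _) eq = guard-group (j xor t) eq
    groupʳ (neither _ _) refl = refl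

    starˡ⁻ : ∀ ρ t j q → labelˡ (inj₁ (ρ , t , j)) (source ρ , t , q) ≡ nothing
    starˡ⁻ ρ t j q with role (source ρ) ρ
    ... | isSource _    = guard-same t _
    ... | isTarget eq   = contradiction (sym eq) (source≢target ρ)
    ... | neither s≢s _ = contradiction refl s≢s

    starʳ⁻ : ∀ ρ i t q → labelʳ (inj₁ (ρ , i , t)) (target ρ , t , q) ≡ nothing
    starʳ⁻ ρ i t q with role (target ρ) ρ
    ... | isSource eq   = contradiction eq (source≢target ρ)
    ... | isTarget _    = guard-same t _
    ... | neither _ t≢t = contradiction refl t≢t

    -- The unique colour of each edge.

    -- Selects, among the four colours of `ρ`, the one realising the difference `inj₁ (ρ , β)`
    -- between tags `t` and `t′` of one group. At an end of the line, the tag that governs the star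
    -- there is chosen to avoid it.
    bits : ∀ {l ρ} → Role l ρ → (t t′ β : Bool) → Bool × Bool
    bits (isSource _)  t t′ β = not t , β
    bits (isTarget _)  t t′ β = β , not t′
    bits (neither _ _) t t′ β = t xor t′ , β

    bits-agree : ∀ {l ρ} (R : Role l ρ) t t′ β {q q′} → inj₁ (ρ , β) ∙ q ≡ q′ → let i , j = bits R t t′ β in
      lineLabelˡ R i j t q ≡ lineLabelʳ R i j t′ q′
    bits-agree (isSource _)  t t′ β refl = guard-not t _
    bits-agree (isTarget _)  t t′ β refl = sym (guard-not t′ _)
    bits-agree (neither _ _) t t′ β refl = cong (λ b → just (_ , b , _)) (xor-cancelˡ t t′)

    bits-unique : ∀ {l ρ i j} (R : Role l ρ) t t′ {q q′} → lineLabelˡ R i j t q ≡ lineLabelʳ R i j t′ q′ →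
      ∃ λ β → inj₁ (ρ , β) ∙ q ≡ q′ × bits R t t′ β ≡ (i , j)
    bits-unique {i = i} {j} (isSource _) t t′ eq with refl , refl ← guard-just i t eq = j , refl , refl
    bits-unique {i = i} {j} (isTarget _) t t′ eq with refl , refl ← guard-just j t′ (sym eq) = i , refl , refl
    bits-unique {i = i} {j} (neither _ _) t t′ refl = j , refl , cong (_, j) (xor-cancelˡ t i)

    colourOf : Group → (t t′ : Bool) → Difference → Colour
    colourOf l t t′ (inj₁ (ρ , β)) = inj₁ (ρ , bits (role l ρ) t t′ β)
    colourOf l t t′ (inj₂ x)       = inj₂ x

    colourOf-agree : ∀ l t t′ d {q q′} → d ∙ q ≡ q′ →
      labelˡ (colourOf l t t′ d) (l , t , q) ≡ labelʳ (colourOf l t t′ d) (l , t′ , q′)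
    colourOf-agree l t t′ (inj₁ (ρ , β)) eq = bits-agree (role l ρ) t t′ β eq
    colourOf-agree l t t′ (inj₂ x)       eq = cong (λ q → just (l , false , q)) eq

    colourOf-unique : ∀ l t t′ e {q q′} → labelˡ e (l , t , q) ≡ labelʳ e (l , t′ , q′) →
      ∃ λ d → d ∙ q ≡ q′ × colourOf l t t′ d ≡ e
    colourOf-unique l t t′ (inj₁ (ρ , _)) eq with β , eq′ , b ← bits-unique (role l ρ) t t′ eq =
      inj₁ (ρ , β) , eq′ , cong (λ ij → inj₁ (ρ , ij)) b
    colourOf-unique l t t′ (inj₂ x) refl = inj₂ x , refl , refl

    -- A label other than the star records its group, so vertices of different groups can agree only
    -- in the star. Membership in the star then fixes both ends of the line and both tags.
    agree-groups : ∀ e {l t q l′ t′ q′} → l ≢ l′ → labelˡ e (l , t , q) ≡ labelʳ e (l′ , t′ , q′) →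
      ∃ λ ρ → source ρ ≡ l × target ρ ≡ l′ × e ≡ inj₁ (ρ , t , t′)
    agree-groups (inj₂ x) l≢l′ refl = contradiction refl l≢l′
    agree-groups (inj₁ (ρ , i , j)) {l} {t} {q} {l′} {t′} {q′} l≢l′ eq
      with lineLabelˡ (role l ρ) i j t q in eqˡ | lineLabelʳ (role l′ ρ) i j t′ q′ in eqʳ
    agree-groups (inj₁ (ρ , i , j)) {l} {t} {q} {l′} {t′} {q′} l≢l′ refl | just _ | just _ =
      contradiction (trans (groupˡ (role l ρ) eqˡ) (sym (groupʳ {i = i} (role l′ ρ) eqʳ))) l≢l′
    agree-groups (inj₁ (ρ , i , j)) {l} {t} {q} {l′} {t′} {q′} l≢l′ eq | nothing | nothing
      with s≡l , refl ← starˡ (role l ρ) eqˡ | t≡l′ , refl ← starʳ {i = i} (role l′ ρ) eqʳ =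
         ρ , s≡l , t≡l′ , refl

    agreeOnce : ∀ a b → ∃! _≡_ λ e → labelˡ e a ≡ labelʳ e b
    agreeOnce (l , t , q) (l′ , t′ , q′) with l Fin.≟ l′
    -- By total symmetry, `q ∙ q′` is the only difference `d` with `d ∙ q ≡ q′`.
    ... | yes refl = colourOf l t t′ (q ∙ q′) , colourOf-agree l t t′ (q ∙ q′) (trans (comm _ q) (cancel q q′)) , λ {e} eq →
      let d , eq′ , c = colourOf-unique l t t′ e eq in trans (cong (colourOf l t t′) (sym (∙-swap d q eq′))) c
    ... | no l≢l′ = inj₁ (ρ , t , t′) , agree , λ {e} eq →
      let σ , s , t , e≡ = agree-groups e l≢l′ eq in
      trans (cong (λ ρ → inj₁ (ρ , _)) (line-unique (sym s) (trans (Fin.punchIn-punchOut l≢l′) (sym t)))) (sym e≡)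
      where
      ρ : Line
      ρ = l , punchOut l≢l′
      agree : labelˡ (inj₁ (ρ , t , t′)) (l , t , q) ≡ labelʳ (inj₁ (ρ , t , t′)) (l′ , t′ , q′)
      agree = trans (starˡ⁻ ρ t t′ q) (sym (subst (λ l → labelʳ (inj₁ (ρ , t , t′)) (l , t′ , q′) ≡ nothing)
        (Fin.punchIn-punchOut l≢l′) (starʳ⁻ ρ t t′ q′)))

    -- Many components and a neighbour in every colour.

    -- A tag at which no right vertex has the star in colour e.
    tagFor : Colour → Bool
    tagFor (inj₁ (_ , _ , j)) = not j
    tagFor (inj₂ _)           = false

    -- Away from the star, a right label retains both the group and `q`. Hence every colour has a
    -- separate component for each pair of a group and a difference.
    labelʳ-injective : ∀ e {l q l′ q′} → labelʳ e (l , tagFor e , q) ≡ labelʳ e (l′ , tagFor e , q′) → (l , q) ≡ (l′ , q′)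
    labelʳ-injective (inj₂ x) refl = refl
    labelʳ-injective (inj₁ (ρ , i , j)) {l} {q} {l′} {q′} eq = cong untag (just-injective (trans (sym lbl) (trans eq lbl′)))
      where
      untag : Point → Group × Difference
      untag (l , _ , q) = l , q
      tagged : ∀ {l} q (R : Role l ρ) → ∃ λ b → lineLabelʳ R i j (not j) q ≡ just (l , b , q)
      tagged q (isSource _)  = false , refl
      tagged q (isTarget _)  = false , trans (cong (λ b → guard b _) (Bool.xor-comm j (not j))) (guard-not j _)
      tagged q (neither _ _) = not j , refl
      lbl  = proj₂ (tagged q (role l ρ))
      lbl′ = proj₂ (tagged q′ (role l′ ρ))

    -- Outside the star, `bits` is solved for the other tag and the difference, which locates a
    -- partner in the same group.
    star-or-bitsˡ : ∀ {l ρ} (R : Role l ρ) i j t q →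
      lineLabelˡ R i j t q ≡ nothing ⊎ ∃ λ t′ → ∃ λ β → bits R t t′ β ≡ (i , j)
    star-or-bitsˡ (isSource _) i j t q with i Bool.≟ t
    ... | yes refl = inj₁ (guard-same i _)
    -- At a source, `bits` is independent of `t′`, so `false` is an arbitrary choice.
    ... | no i≢t   = inj₂ (false , j , cong (_, j) (sym (Bool.¬-not i≢t)))
    star-or-bitsˡ (isTarget _) i j t q  = inj₂ (not j , i , cong (i ,_) (Bool.not-involutive j))
    star-or-bitsˡ (neither _ _) i j t q = inj₂ (t xor i , j , cong (_, j) (xor-cancelˡ t i))

    star-or-bitsʳ : ∀ {l ρ} (R : Role l ρ) i j t′ q →
      lineLabelʳ R i j t′ q ≡ nothing ⊎ ∃ λ t → ∃ λ β → bits R t t′ β ≡ (i , j)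
    star-or-bitsʳ (isSource _) i j t′ q = inj₂ (not i , j , cong (_, j) (Bool.not-involutive i))
    star-or-bitsʳ (isTarget _) i j t′ q with j Bool.≟ t′
    ... | yes refl = inj₁ (guard-same j _)
    ... | no j≢t′  = inj₂ (false , i , cong (i ,_) (sym (Bool.¬-not j≢t′)))
    star-or-bitsʳ (neither _ _) i j t′ q = inj₂ (t′ xor i , j ,
      cong (_, j) (trans (Bool.xor-comm (t′ xor i) t′) (xor-cancelˡ t′ i)))

    neighbourˡ : ∀ e a → ∃ λ b → labelˡ e a ≡ labelʳ e b
    neighbourˡ (inj₂ x) (l , t , q) = (l , false , inj₂ x ∙ q) , refl
    neighbourˡ (inj₁ (ρ , i , j)) (l , t , q) with star-or-bitsˡ (role l ρ) i j t q
    -- Every right vertex of the target group with tag `j` lies in the star; `q` is an arbitrary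
    -- choice.
    ... | inj₁ isStar = (target ρ , j , q) , trans isStar (sym (starʳ⁻ ρ i j q))
    ... | inj₂ (t′ , β , refl) = (l , t′ , inj₁ (ρ , β) ∙ q) , bits-agree (role l ρ) t t′ β refl

    neighbourʳ : ∀ e b → ∃ λ a → labelˡ e a ≡ labelʳ e b
    neighbourʳ (inj₂ x) (l , t , q) = (l , false , inj₂ x ∙ q) , cong (λ q → just (l , false , q)) (cancel (inj₂ x) q)
    neighbourʳ (inj₁ (ρ , i , j)) (l , t , q) with star-or-bitsʳ (role l ρ) i j t q
    ... | inj₁ isStar = (source ρ , i , q) , trans (starˡ⁻ ρ i j q) (sym isStar)
    ... | inj₂ (t′ , β , refl) = (l , t′ , inj₁ (ρ , β) ∙ q) , bits-agree (role l ρ) t′ t β (cancel (inj₁ (ρ , β)) q)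

    _≟_ : DecidableEquality Label
    _≟_ = ≡-dec (Product.≡-dec Fin._≟_ (Product.≡-dec Bool._≟_
      (Sum.≡-dec (Product.≡-dec (Product.≡-dec Fin._≟_ Fin._≟_) Bool._≟_) Fin._≟_)))

  -- Enumeration of differences, colours and vertices.

  Difference-finite : Fin (suc k * k * 2 + n) ↔ Difference
  Difference-finite =
    ((Fin.*↔× ×-↔ Fin.2↔Bool) ↔-∘ Fin.*↔× ⊎-↔ ↔-id _) ↔-∘ Fin.+↔⊎

  Root-finite : Fin (suc k * (suc k * k * 2 + n)) ↔ (Group × Difference)
  Root-finite = (↔-id _ ×-↔ Difference-finite) ↔-∘ Fin.*↔×

  Colour-finite : Fin (suc k * k * 4 + n) ↔ Colour
  Colour-finite =
    ((Fin.*↔× ×-↔ (Fin.2↔Bool ×-↔ Fin.2↔Bool) ↔-∘ Fin.*↔×) ↔-∘ Fin.*↔× ⊎-↔ ↔-id _) ↔-∘ Fin.+↔⊎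

  open Labels (quasigroup-transport Difference-finite (fin-quasigroup _)) public

  Vertex-finite : Fin (2 * (suc k * (2 * (suc k * k * 2 + n)))) ↔ (Bool × Point)
  Vertex-finite = (Fin.2↔Bool ×-↔
    (↔-id _ ×-↔ (Fin.2↔Bool ×-↔ Difference-finite) ↔-∘ Fin.*↔×) ↔-∘ Fin.*↔×) ↔-∘ Fin.*↔×

-- Assembly for every positive `r`.

Realisable : ℚ → ℕ → Set₁
Realisable c r =
  ∃ λ (n : ℕ) → Σ (Graph (Fin n)) λ K → IsBiclique K ×
    Σ (Fin r → Graph (Fin n)) λ G → IsPartition K G × IsSpanning K G ×
      (∀ i → ∃ λ (w : ℕ) → HasWidth (G i) w × (c · r ^3/2≤ w))

construction-realises : ∀ k n → let r = suc k * k * 4 + n in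
  0 ℕ.< r → r ℕ.< suc (suc k) * suc k * 4 → Realisable c r
construction-realises k n 0<r hi =
  _ , K , K-biclique , G , partition , spanning , λ i →
    let w , hasWidth , wide = width i (root i) (root-injective i)
    in w , hasWidth , c-bound r w (cube-bound k n hi wide)
  where
  open Construction k n

  r = suc k * k * 4 + n

  module Vtx = Inverse Vertex-finite
  module Col = Inverse Colour-finite

  labelAt : Colour → Bool × Point → Label
  labelAt e (true  , a) = labelˡ e a
  labelAt e (false , b) = labelʳ e b

  side : Fin _ → Bool
  side v = proj₁ (Vtx.to v)

  label : Fin r → Fin _ → Label
  label i v = labelAt (Col.to i) (Vtx.to v)

  point : Point
  -- As `r` is positive there is a first colour, and it supplies a difference, which makes both
  -- sides nonempty.
  point with Col.to (fromℕ< 0<r)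
  ... | inj₁ (ρ , i , _) = zero , true , inj₁ (ρ , i)
  ... | inj₂ x           = zero , true , inj₂ x

  bothSides : ∀ b → ∃ λ v → side v ≡ b
  bothSides b = Vtx.from (b , point) , cong proj₁ (Vtx.strictlyInverseˡ (b , point))

  neighbourAt : ∀ e x → ∃ λ y → proj₁ x ≢ proj₁ y × labelAt e x ≡ labelAt e y
  neighbourAt e (true  , a) = let b , eq = neighbourˡ e a in (false , b) , (λ ()) , eq
  neighbourAt e (false , b) = let a , eq = neighbourʳ e b in (true , a) , (λ ()) , sym eq

  neighbour : ∀ i v → ∃ λ u → side v ≢ side u × label i v ≡ label i u
  neighbour i v with y , x≢y , eq ← neighbourAt (Col.to i) (Vtx.to v) =
    Vtx.from y , subst (λ y → side v ≢ proj₁ y × label i v ≡ labelAt (Col.to i) y)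
      (sym (Vtx.strictlyInverseˡ y)) (x≢y , eq)

  agreeAt : ∀ x y → proj₁ x ≢ proj₁ y → ∃! _≡_ λ e → labelAt e x ≡ labelAt e y
  agreeAt (true  , a) (true  , b) x≢y = contradiction refl x≢y
  agreeAt (true  , a) (false , b) x≢y = agreeOnce a b
  agreeAt (false , b) (true  , a) x≢y = let e , eq , unique = agreeOnce a b in e , sym eq , unique ∘ sym
  agreeAt (false , a) (false , b) x≢y = contradiction refl x≢y

  agree : ∀ u v → side u ≢ side v → ∃! _≡_ λ i → label i u ≡ label i v
  agree u v u≢v with e , eq , unique ← agreeAt (Vtx.to u) (Vtx.to v) u≢v =
    Col.from e ,
    subst (λ e → labelAt e (Vtx.to u) ≡ labelAt e (Vtx.to v)) (sym (Col.strictlyInverseˡ e)) eq ,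
    λ {i} eq′ → trans (cong Col.from (unique eq′)) (Col.strictlyInverseʳ i)

  open Labelled _≟_ side label bothSides neighbour agree

  module Root = Inverse Root-finite

  rootPoint : Fin r → Group × Difference → Point
  rootPoint i (l , q) = l , tagFor (Col.to i) , q

  root : Fin r → Fin (suc k * (suc k * k * 2 + n)) → Fin _
  root i x = Vtx.from (false , rootPoint i (Root.to x))

  root-label : ∀ i x → label i (root i x) ≡ labelʳ (Col.to i) (rootPoint i (Root.to x))
  root-label i x = cong (labelAt (Col.to i)) (Vtx.strictlyInverseˡ (false , rootPoint i (Root.to x)))

  root-injective : ∀ i x y → label i (root i x) ≡ label i (root i y) → x ≡ y
  root-injective i x y eq = Injection.injective (↔⇒↣ Root-finite)
    (labelʳ-injective (Col.to i) (trans (sym (root-label i x)) (trans eq (root-label i y))))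

theorem4 : ∃ λ (c : ℚ) → 0ℚ < c ×
    ((r : ℕ) → .{{_ : NonZero r}} →
    ∃ λ (n : ℕ) → Σ (Graph (Fin n)) λ K → IsBiclique K ×
    Σ (Fin r → Graph (Fin n)) λ G → IsPartition K G × IsSpanning K G ×
    (∀ i → ∃ λ (w : ℕ) → HasWidth (G i) w × (c · r ^3/2≤ w)))
theorem4 = c , 0<c , realise
  where
  realise : ∀ r → .{{_ : NonZero r}} → Realisable c r
  realise r with k , lo , hi ← group-count r =
    -- Colours beyond those reserved for the star become the `inj₂` colours, which use only the
    -- Latin square in every group.
    subst (Realisable c) r≡ (construction-realises k (r ∸ suc k * k * 4)
      (subst (0 ℕ.<_) (sym r≡) (ℕ.>-nonZero⁻¹ r)) (subst (ℕ._< _) (sym r≡) hi))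
    where r≡ = ℕ.m+[n∸m]≡n lo
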